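{- Let $G$ be a fixed edge-ordered graph with minimal edge $e_0$. If $e_0$ is isolated in $G$, then $ssat_m(n,G)=O(1)$; otherwise $ssat_m(n,G)=\Omega(n)$.
   Context: An edge-ordered graph is a finite simple graph together with a linear order on its edge set (usually given by an injective labeling $l:E\to\mathbb{N}$ or $l:E\to\mathbb{R}$). A copy of $G$ in an edge-ordered graph $H$ is a subgraph of $H$ (with the induced edge-order) isomorphic to $G$ by an isomorphism respecting the edge-order. The minimal edge $e_0$ of $G$ is the edge with the smallest label; an edge is isolated if it shares no vertex with any other edge. $ssat_m(n,G)$ is the minimum number of edges in an edge-ordered graph $H$ on $n$ vertices (not required to be $G$-free) such that adding to $H$ any missing edge, inserted at the beginning of the linear order (i.e. with a label smaller than all labels of $H$), creates a new copy of $G$ (one using the added edge). Asymptotic notation is for $n\to\infty$ with $G$ fixed ($n$ is assumed large enough). -}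

module Defs where

open import Data.Empty using (⊥-elim-irr)
open import Data.Fin.Base using (Fin; zero; suc; _<_; _≤_; funToFin; finToFun)
open import Data.Fin.Properties using (_≟_; _<?_; any?; all?; finToFun-funToFin)
open import Data.Integer.Base using (+_)
open import Data.List.Base
  using (List; []; _∷_; length; lookup; allFin; cartesianProduct; concatMap; deduplicate)
open import Data.List.Membership.Propositional using (_∈_; _∉_; find; lose)
open import Data.List.Membership.Propositional.Properties
  using (∈-allFin; ∈-cartesianProduct⁺; ∈-concatMap⁺; ∈-deduplicate⁺)
import Data.List.Membership.DecPropositional as DecMembership
open import Data.List.Relation.Unary.All as All using (All)
open import Data.List.Relation.Unary.All.Properties using (¬Any⇒All¬)
open import Data.List.Relation.Unary.Any as Any using (here; there)
open import Data.List.Relation.Unary.AllPairs using (_∷_)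
open import Data.List.Relation.Unary.Unique.Propositional using (Unique)
import Data.List.Relation.Unary.Unique.DecPropositional as DecUnique
import Data.List.Relation.Unary.Unique.DecPropositional.Properties as DecUniqueProps
open import Data.Nat.Base as ℕ using (ℕ; zero; suc)
open import Data.Nat.Properties as ℕ using (anyUpTo?; suc-injective)
open import Data.Nat.Induction using (<-rec)
open import Data.Product.Base using (Σ; ∃; ∃-syntax; _×_; _,_; proj₁; proj₂)
open import Data.Rational.Base as ℚ using (ℚ; 0ℚ)
open import Data.Sum.Base using (_⊎_)
open import Function.Base using (_∘_)
open import Function.Definitions using (Injective)
open import Relation.Binary.Definitions using (DecidableEquality; Monotonic₁)
open import Relation.Binary.PropositionalEquality
  using (_≡_; _≢_; _≗_; refl; sym; trans; cong; subst; subst₂)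
open import Relation.Nullary using (¬_; Dec; yes; no; contradiction)
open import Relation.Nullary.Decidable using (map′; _×-dec_; _⊎-dec_; _→-dec_)
open import Relation.Unary using (Decidable)

------------------------------------------------------------------------
-- Edge-ordered graphs

-- An unordered pair of distinct vertices, written with the smaller vertex
-- first so that propositional equality is equality of unordered pairs.
record Edge (n : ℕ) : Set where
  constructor mkEdge
  field
    src tgt   : Fin n
    .src<tgt  : src < tgt

open Edge public

_∈ₑ_ : ∀ {n} → Fin n → Edge n → Set
v ∈ₑ e = v ≡ src e ⊎ v ≡ tgt e

-- e = {u , v}
Joins : ∀ {n} → Edge n → Fin n → Fin n → Set
Joins e u v = (src e ≡ u × tgt e ≡ v) ⊎ (src e ≡ v × tgt e ≡ u)

-- The vertex set is Fin n.  A linear order on the finite edge set is given by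
-- listing the edges without repetition, from the smallest to the largest; the
-- position of an edge in the list serves as its label.
record EdgeOrderedGraph (n : ℕ) : Set where
  constructor mkGraph
  field
    edges    : List (Edge n)
    .unique  : Unique edges

  size : ℕ
  size = length edges

  -- The edge with label p; the edge-order is the order _<_ of labels.
  edge : Fin size → Edge n
  edge = lookup edges

open EdgeOrderedGraph public

IsMinimalEdge : ∀ {n} (G : EdgeOrderedGraph n) → Fin (size G) → Set
IsMinimalEdge G e₀ = ∀ (e : Fin (size G)) → e₀ ≤ e

IsIsolatedEdge : ∀ {n} (G : EdgeOrderedGraph n) → Fin (size G) → Set
IsIsolatedEdge G e = ∀ f → f ≢ e → ∀ v → v ∈ₑ edge G e → ¬ (v ∈ₑ edge G f)

------------------------------------------------------------------------
-- Copies

-- A copy is presented by the order-respecting isomorphism onto the subgraph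
-- of H (not necessarily induced) which is its image.
record Copy {k n} (G : EdgeOrderedGraph k) (H : EdgeOrderedGraph n) : Set where
  field
    vertexMap       : Fin k → Fin n
    vertexMap-inj   : Injective _≡_ _≡_ vertexMap
    edgeMap         : Fin (size G) → Fin (size H)
    edgeMap-mono    : Monotonic₁ _<_ _<_ edgeMap
    edgeMap-joins   : ∀ e → Joins (edge H (edgeMap e))
                                  (vertexMap (src (edge G e)))
                                  (vertexMap (tgt (edge G e)))

open Copy public

UsesEdge : ∀ {k n} {G : EdgeOrderedGraph k} {H : EdgeOrderedGraph n} →
           Copy G H → Fin (size H) → Set
UsesEdge c f = ∃[ e ] edgeMap c e ≡ f

------------------------------------------------------------------------
-- Semisaturation with respect to insertion at the beginning of the order

insertMin : ∀ {n} (H : EdgeOrderedGraph n) (e : Edge n) → .(e ∉ edges H) →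
            EdgeOrderedGraph n
insertMin (mkGraph es u) e e∉H = mkGraph (e ∷ es) (¬Any⇒All¬ es e∉H ∷ u)

-- The inserted edge has label zero in insertMin H e e∉H.
SemiSaturated : ∀ {k n} → EdgeOrderedGraph k → EdgeOrderedGraph n → Set
SemiSaturated G H = ∀ e (e∉H : e ∉ edges H) →
  Σ (Copy G (insertMin H e e∉H)) λ c → UsesEdge c zero

record IsMinimum (P : ℕ → Set) (m : ℕ) : Set where
  field
    attained    : P m
    lowerBound  : ∀ k → P k → m ℕ.≤ k

open IsMinimum public

IsSemiSaturatedSize : ∀ {k} → ℕ → EdgeOrderedGraph k → ℕ → Set
IsSemiSaturatedSize n G s =
  Σ (EdgeOrderedGraph n) λ H → SemiSaturated G H × size H ≡ s

------------------------------------------------------------------------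
-- Existence of the minimum: semisaturation is decidable by finite search,
-- and the complete graph is vacuously semisaturated.

private
  Searchable : Set → Set₁
  Searchable A = ∀ {P : A → Set} → Decidable P → Dec (∃ P)

  searchFunction : ∀ {m n} {P : (Fin m → Fin n) → Set} →
                   (∀ {f g} → f ≗ g → P f → P g) → Decidable P → Dec (∃ P)
  searchFunction resp P? = map′
    (λ (i , p) → finToFun i , p)
    (λ (f , p) → funToFin f , resp (sym ∘ finToFun-funToFin f) p)
    (any? (λ i → P? (finToFun i)))

  searchList : ∀ {A} → Searchable A → ∀ s {P : List A → Set} → Decidable P →
               Dec (∃ λ xs → length xs ≡ s × P xs)
  searchList search zero P? = map′
    (λ p → [] , refl , p)
    (λ { ([] , _ , p) → p })
    (P? [])
  searchList search (suc s) P? = map′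
    (λ (x , xs , eq , p) → x ∷ xs , cong suc eq , p)
    (λ { (x ∷ xs , eq , p) → x , xs , suc-injective eq , p })
    (search (λ x → searchList search s (λ xs → P? (x ∷ xs))))

  _≟ₑ_ : ∀ {n} → DecidableEquality (Edge n)
  e ≟ₑ f = map′ (λ { (refl , refl) → refl }) (λ { refl → refl , refl })
                (src e ≟ src f ×-dec tgt e ≟ tgt f)

  asEdge : ∀ {n} → Fin n × Fin n → List (Edge n)
  asEdge (i , j) with i <? j
  ... | yes i<j = mkEdge i j i<j ∷ []
  ... | no  _   = []

  ∈-asEdge : ∀ {n} (e : Edge n) → e ∈ asEdge (src e , tgt e)
  ∈-asEdge (mkEdge i j i<j) with i <? j
  ... | yes _   = here refl
  ... | no  i≮j = ⊥-elim-irr (i≮j i<j)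

  allEdges : ∀ n → List (Edge n)
  allEdges n = concatMap asEdge (cartesianProduct (allFin n) (allFin n))

  ∈-allEdges : ∀ {n} (e : Edge n) → e ∈ allEdges n
  ∈-allEdges e = ∈-concatMap⁺ asEdge
    (lose (∈-cartesianProduct⁺ (∈-allFin (src e)) (∈-allFin (tgt e))) (∈-asEdge e))

  searchEdge : ∀ {n} → Searchable (Edge n)
  searchEdge {n} P? = map′
    (λ a → let (e , _ , p) = find a in e , p)
    (λ (e , p) → lose (∈-allEdges e) p)
    (Any.any? P? (allEdges n))

  complete : ∀ n → EdgeOrderedGraph n
  complete n = mkGraph (deduplicate _≟ₑ_ (allEdges n))
                       (DecUniqueProps.deduplicate-! _≟ₑ_ (allEdges n))

  complete-semiSaturated : ∀ {k} n (G : EdgeOrderedGraph k) →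
                           SemiSaturated G (complete n)
  complete-semiSaturated n G e e∉ =
    contradiction (∈-deduplicate⁺ _≟ₑ_ (∈-allEdges e)) e∉

  module _ {k n} (G : EdgeOrderedGraph k) (H : EdgeOrderedGraph n) (q : Fin (size H)) where

    IsCopy : (Fin k → Fin n) → (Fin (size G) → Fin (size H)) → Set
    IsCopy φ ψ =
      (∀ x y → φ x ≡ φ y → x ≡ y) ×
      (∀ x y → x < y → ψ x < ψ y) ×
      (∀ e → Joins (edge H (ψ e)) (φ (src (edge G e))) (φ (tgt (edge G e)))) ×
      (∃[ e ] ψ e ≡ q)

    isCopy? : ∀ φ ψ → Dec (IsCopy φ ψ)
    isCopy? φ ψ =
      all? (λ x → all? λ y → φ x ≟ φ y →-dec x ≟ y) ×-dec
      all? (λ x → all? λ y → x <? y →-dec ψ x <? ψ y) ×-dec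
      all? (λ e → (src (edge H (ψ e)) ≟ _ ×-dec tgt (edge H (ψ e)) ≟ _)
                  ⊎-dec (src (edge H (ψ e)) ≟ _ ×-dec tgt (edge H (ψ e)) ≟ _)) ×-dec
      any? (λ e → ψ e ≟ q)

    isCopy-resp : ∀ {φ φ′ ψ ψ′} → φ ≗ φ′ → ψ ≗ ψ′ → IsCopy φ ψ → IsCopy φ′ ψ′
    isCopy-resp {φ} {φ′} {ψ} {ψ′} φ≗ ψ≗ (inj , mono , joins , e , uses) =
      (λ x y eq → inj x y (trans (φ≗ x) (trans eq (sym (φ≗ y))))) ,
      (λ x y x<y → subst₂ _<_ (ψ≗ x) (ψ≗ y) (mono x y x<y)) ,
      (λ f → subst (λ r → Joins (edge H r) _ _) (ψ≗ f)
               (subst₂ (Joins (edge H (ψ f))) (φ≗ _) (φ≗ _) (joins f))) ,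
      e , trans (sym (ψ≗ e)) uses

    copyUsing? : Dec (Σ (Copy G H) λ c → UsesEdge c q)
    copyUsing? = map′
      (λ (φ , ψ , inj , mono , joins , uses) →
        record { vertexMap = φ ; vertexMap-inj = inj _ _ ; edgeMap = ψ
               ; edgeMap-mono = mono _ _ ; edgeMap-joins = joins } , uses)
      (λ (c , uses) → vertexMap c , edgeMap c ,
        (λ _ _ → vertexMap-inj c) , (λ _ _ → edgeMap-mono c) , edgeMap-joins c , uses)
      (searchFunction
        (λ φ≗ (ψ , p) → ψ , isCopy-resp φ≗ (λ _ → refl) p)
        (λ φ → searchFunction (isCopy-resp (λ _ → refl)) (isCopy? φ)))

  semiSaturated? : ∀ {k n} (G : EdgeOrderedGraph k) (H : EdgeOrderedGraph n) →
                   Dec (SemiSaturated G H)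
  semiSaturated? {n = n} G H = map′
    (λ all e → All.lookup all (∈-allEdges e))
    (λ sat → All.universal sat (allEdges n))
    (All.all? saturatedAt? (allEdges n))
    where
    saturatedAt? : ∀ e → Dec ((e∉H : e ∉ edges H) →
                   Σ (Copy G (insertMin H e e∉H)) λ c → UsesEdge c zero)
    saturatedAt? e with DecMembership._∈?_ _≟ₑ_ e (edges H)
    ... | yes e∈H = yes (λ e∉H → contradiction e∈H e∉H)
    ... | no  e∉H = map′ (λ p _ → p) (λ p → p e∉H)
                         (copyUsing? G (insertMin H e e∉H) zero)

  isSemiSaturatedSize? : ∀ {k} n (G : EdgeOrderedGraph k) →
                         Decidable (IsSemiSaturatedSize n G)
  isSemiSaturatedSize? n G s = map′
    (λ (xs , eq , u , sat) → mkGraph xs u , sat , eq)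
    (λ (H , sat , eq) → edges H , eq , recomputeUnique H , sat)
    (searchList searchEdge s listed?)
    where
    recomputeUnique : (H : EdgeOrderedGraph n) → Unique (edges H)
    recomputeUnique (mkGraph xs u) with DecUnique.unique? _≟ₑ_ xs
    ... | yes v = v
    ... | no ¬u = ⊥-elim-irr (¬u u)

    listed? : ∀ xs → Dec (Σ (Unique xs) λ u → SemiSaturated G (mkGraph xs u))
    listed? xs with DecUnique.unique? _≟ₑ_ xs
    ... | no ¬u = no (¬u ∘ proj₁)
    ... | yes u = map′ (u ,_) proj₂ (semiSaturated? G (mkGraph xs u))

  minimum : ∀ {P : ℕ → Set} → Decidable P → ∀ b → P b → ∃ (IsMinimum P)
  minimum {P} P? = <-rec _ step
    where
    step : ∀ b → (∀ {c} → c ℕ.< b → P c → ∃ (IsMinimum P)) → P b → ∃ (IsMinimum P)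
    step b rec pb with anyUpTo? P? b
    ... | yes (c , c<b , pc) = rec c<b pc
    ... | no none = b , record
      { attained = pb ; lowerBound = λ k pk → ℕ.≮⇒≥ λ k<b → none (k , k<b , pk) }

ssatₘ-minimum : ∀ {k} n (G : EdgeOrderedGraph k) → ∃ (IsMinimum (IsSemiSaturatedSize n G))
ssatₘ-minimum n G = minimum (isSemiSaturatedSize? n G) (size (complete n))
  (complete n , complete-semiSaturated n G , refl)

-- All that matters about this number is ssatₘ-isMinimum.
abstract
  ssatₘ : ∀ {k} → ℕ → EdgeOrderedGraph k → ℕ
  ssatₘ n G = proj₁ (ssatₘ-minimum n G)

  ssatₘ-isMinimum : ∀ {k} n (G : EdgeOrderedGraph k) →
                    IsMinimum (IsSemiSaturatedSize n G) (ssatₘ n G)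
  ssatₘ-isMinimum n G = proj₂ (ssatₘ-minimum n G)

------------------------------------------------------------------------
-- Asymptotic notation (n → ∞)

fromℕ : ℕ → ℚ
fromℕ n = + n ℚ./ 1

-- Rational constants suffice in place of real ones, by density.
_∈O_ : (ℕ → ℕ) → (ℕ → ℕ) → Set
f ∈O g = ∃[ C ] (0ℚ ℚ.< C × ∃[ n₀ ] ∀ n → n₀ ℕ.≤ n →
           fromℕ (f n) ℚ.≤ C ℚ.* fromℕ (g n))

_∈Ω_ : (ℕ → ℕ) → (ℕ → ℕ) → Set
f ∈Ω g = ∃[ c ] (0ℚ ℚ.< c × ∃[ n₀ ] ∀ n → n₀ ℕ.≤ n →
           c ℚ.* fromℕ (g n) ℚ.≤ fromℕ (f n))

{-# OPTIONS --safe #-}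

-- If the minimal edge e₀ is isolated, let H be three disjoint copies of G,
-- with the order of G on each copy.  The endpoints of an inserted edge e meet
-- at most two of the copies, so e together with the third copy without its
-- minimal edge is a copy of G.
-- If e₀ is not isolated, at most one vertex of H is uncovered: an inserted
-- edge joining two uncovered vertices is isolated, yet it is the minimal edge
-- of a copy of G.  Hence n ≤ 1 + 2 |E(H)|.
module Submission where

open import Defs
open import Data.Empty using (⊥-elim-irr)
open import Data.Fin.Base
  using (Fin; zero; suc; _<_; cast; combine; remQuot; inject≤; toℕ)
open import Data.Fin.Properties as Fin
  using (_≟_; any?; all?; toℕ-cast; toℕ-combine; toℕ-inject≤; combine-injective;
         combine-remQuot; remQuot-combine; inject≤-injective; injective⇒≤;
         pigeonhole; <⇒≢; ≤∧≢⇒<; <-cmp)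
open import Data.Integer.Base as ℤ using (+_; +≤+)
open import Data.Integer.Properties using (pos-*) renaming (*-identityʳ to ℤ-*-identityʳ)
open import Data.List.Base using (List; _∷_; length; lookup; tabulate)
open import Data.List.Membership.Propositional using (_∉_)
open import Data.List.Membership.Propositional.Properties using (∈-lookup)
open import Data.List.Properties using (length-tabulate; lookup-tabulate)
import Data.List.Relation.Unary.All as All
open import Data.List.Relation.Unary.AllPairs using (_∷_)
open import Data.List.Relation.Unary.Any using (index)
open import Data.List.Relation.Unary.Any.Properties using (lookup-index)
open import Data.List.Relation.Unary.Unique.Propositional using (Unique)
open import Data.List.Relation.Unary.Unique.Propositional.Properties using (tabulate⁺)
open import Data.Nat.Base as ℕ using (ℕ; zero; suc)
import Data.Nat.Properties as ℕ
open import Data.Product.Base using (Σ; ∃-syntax; _×_; _,_; proj₁; proj₂; uncurry)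
open import Data.Rational.Base as ℚ using (1ℚ; toℚᵘ)
import Data.Rational.Properties as ℚ
open import Data.Rational.Unnormalised.Base as ℚᵘ using (mkℚᵘ; _≃_)
import Data.Rational.Unnormalised.Properties as ℚᵘ
open import Data.Sum.Base as Sum using (_⊎_; inj₁; inj₂)
open import Data.Vec.Functional using (updateAt)
open import Data.Vec.Functional.Properties using (updateAt-updates; updateAt-minimal)
open import Function.Base using (_∘_; const)
open import Function.Definitions using (Injective)
open import Relation.Binary.Definitions using (tri<; tri≈; tri>)
open import Relation.Binary.PropositionalEquality
  using (_≡_; _≢_; refl; sym; trans; cong; cong₂; subst; subst₂; module ≡-Reasoning)
open import Relation.Nullary using (¬_; Dec; yes; no; contradiction)
open import Relation.Nullary.Decidable using (_×-dec_; ¬?)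

private
  variable
    k m n : ℕ

-- Arithmetic of fromℕ

toℚᵘ-fromℕ : ∀ n → toℚᵘ (fromℕ n) ≃ mkℚᵘ (+ n) 0
toℚᵘ-fromℕ n = ℚ.toℚᵘ-fromℚᵘ (mkℚᵘ (+ n) 0)

fromℕ-mono-≤ : m ℕ.≤ n → fromℕ m ℚ.≤ fromℕ n
fromℕ-mono-≤ {m} {n} m≤n = ℚ.toℚᵘ-cancel-≤ (begin
  toℚᵘ (fromℕ m)  ≃⟨ toℚᵘ-fromℕ m ⟩
  mkℚᵘ (+ m) 0    ≤⟨ ℚᵘ.*≤* (subst₂ ℤ._≤_
                       (sym (ℤ-*-identityʳ (+ m))) (sym (ℤ-*-identityʳ (+ n))) (+≤+ m≤n)) ⟩
  mkℚᵘ (+ n) 0    ≃⟨ toℚᵘ-fromℕ n ⟨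
  toℚᵘ (fromℕ n)  ∎)
  where open ℚᵘ.≤-Reasoning

fromℕ-homo-* : ∀ m n → fromℕ (m ℕ.* n) ≡ fromℕ m ℚ.* fromℕ n
fromℕ-homo-* m n = ℚ.toℚᵘ-injective (begin
  toℚᵘ (fromℕ (m ℕ.* n))              ≈⟨ toℚᵘ-fromℕ (m ℕ.* n) ⟩
  mkℚᵘ (+ (m ℕ.* n)) 0                ≡⟨ cong (λ i → mkℚᵘ i 0) (pos-* m n) ⟩
  mkℚᵘ (+ m) 0 ℚᵘ.* mkℚᵘ (+ n) 0      ≈⟨ ℚᵘ.*-cong (toℚᵘ-fromℕ m) (toℚᵘ-fromℕ n) ⟨
  toℚᵘ (fromℕ m) ℚᵘ.* toℚᵘ (fromℕ n)  ≈⟨ ℚ.toℚᵘ-homo-* (fromℕ m) (fromℕ n) ⟨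
  toℚᵘ (fromℕ m ℚ.* fromℕ n)          ∎)
  where open import Relation.Binary.Reasoning.Setoid ℚᵘ.≃-setoid

bounded⇒∈O1 : ∀ (f : ℕ → ℕ) b n₀ → (∀ n → n₀ ℕ.≤ n → f n ℕ.≤ b) → f ∈O (λ _ → 1)
bounded⇒∈O1 f b n₀ f≤b =
  -- The constant must be strictly positive, hence `suc b` even when `b` is zero.
  fromℕ (suc b) , ℚ.positive⁻¹ _ {{ℚ.normalize-pos (suc b) 1}} , n₀ , λ n n₀≤n → begin
    fromℕ (f n)              ≤⟨ fromℕ-mono-≤ (ℕ.m≤n⇒m≤1+n (f≤b n n₀≤n)) ⟩
    fromℕ (suc b)            ≡⟨ ℚ.*-identityʳ (fromℕ (suc b)) ⟨
    fromℕ (suc b) ℚ.* 1ℚ     ∎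
  where open ℚ.≤-Reasoning

linear⇒∈Ωn : ∀ (f : ℕ → ℕ) n₀ → (∀ n → n₀ ℕ.≤ n → n ℕ.≤ 4 ℕ.* f n) → f ∈Ω (λ n → n)
linear⇒∈Ωn f n₀ n≤4f = ¼ , ℚ.positive⁻¹ ¼ , n₀ , λ n n₀≤n → begin
    ¼ ℚ.* fromℕ n                      ≤⟨ ℚ.*-monoˡ-≤-nonNeg ¼ (fromℕ-mono-≤ (n≤4f n n₀≤n)) ⟩
    ¼ ℚ.* fromℕ (4 ℕ.* f n)            ≡⟨ cong (¼ ℚ.*_) (fromℕ-homo-* 4 (f n)) ⟩
    ¼ ℚ.* (fromℕ 4 ℚ.* fromℕ (f n))    ≡⟨ ℚ.*-assoc ¼ (fromℕ 4) (fromℕ (f n)) ⟨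
    -- The closed product `¼ ℚ.* fromℕ 4` evaluates to `1ℚ`.
    1ℚ ℚ.* fromℕ (f n)                 ≡⟨ ℚ.*-identityˡ (fromℕ (f n)) ⟩
    fromℕ (f n)                        ∎
  where
  open ℚ.≤-Reasoning
  ¼ = + 1 ℚ./ 4

-- Upper bound for an isolated minimal edge

lookup-injective : ∀ {A : Set} {xs : List A} → Unique xs → Injective _≡_ _≡_ (lookup xs)
lookup-injective (_   ∷ _) {zero}  {zero}  _  = refl
lookup-injective (x∉  ∷ _) {zero}  {suc j} eq = contradiction eq (All.lookup x∉ (∈-lookup j))
lookup-injective (x∉  ∷ _) {suc i} {zero}  eq = contradiction (sym eq) (All.lookup x∉ (∈-lookup i))
lookup-injective (_   ∷ u) {suc i} {suc j} eq = cong suc (lookup-injective u eq)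

-- The new value lies outside the image of `f`, so the changed entry collides with no other. Two
-- such updates will move the ends of the minimal edge onto those of the inserted edge.
updateAt-injective : ∀ {f : Fin k → Fin n} x {u} → Injective _≡_ _≡_ f →
                     (∀ y → f y ≢ u) → Injective _≡_ _≡_ (updateAt f x (const u))
updateAt-injective {f = f} x f-inj f≢u {y} {z} eq with y ≟ x | z ≟ x
... | yes refl | yes refl = refl
... | yes refl | no  z≢x  = contradiction
  (trans (sym (updateAt-minimal z x f z≢x)) (trans (sym eq) (updateAt-updates x f))) (f≢u z)
... | no  y≢x  | yes refl = contradiction
  (trans (sym (updateAt-minimal y x f y≢x)) (trans eq (updateAt-updates x f))) (f≢u y)
... | no  y≢x  | no  z≢x  = f-inj
  (trans (sym (updateAt-minimal y x f y≢x)) (trans eq (updateAt-minimal z x f z≢x)))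

-- Links the two updates: once one vertex has been sent to `src e`, the map must still avoid
-- `tgt e`.
updateAt-avoids : ∀ {f : Fin k → Fin n} x {u v} → u ≢ v →
                  (∀ y → f y ≢ v) → ∀ y → updateAt f x (const u) y ≢ v
updateAt-avoids {f = f} x u≢v f≢v y eq with y ≟ x
... | yes refl = u≢v (trans (sym (updateAt-updates x f)) eq)
... | no  y≢x  = f≢v y (trans (sym (updateAt-minimal y x f y≢x)) eq)

-- `combine i` is a shift by the constant `n * toℕ i`. This keeps `src < tgt` for the edges of a
-- copy and keeps the order of their labels.
combine-monoʳ-< : ∀ (i : Fin m) {j l : Fin n} → j < l → combine i j < combine i l
combine-monoʳ-< {n = n} i {j} {l} j<l = subst₂ ℕ._<_
  (sym (toℕ-combine i j)) (sym (toℕ-combine i l)) (ℕ.+-monoʳ-< (n ℕ.* toℕ i) j<l)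

src≢tgt : (e : Edge n) → src e ≢ tgt e
src≢tgt (mkEdge x y x<y) eq = ⊥-elim-irr (<⇒≢ x<y eq)

edge-≡ : {e f : Edge n} → src e ≡ src f → tgt e ≡ tgt f → e ≡ f
edge-≡ refl refl = refl

-- Disjoint copies on consecutive blocks of vertices

module DisjointCopies (c k : ℕ) {n : ℕ} (ck≤n : c ℕ.* k ℕ.≤ n) where

  place : Fin c → Fin k → Fin n
  place i x = inject≤ (combine i x) ck≤n

  place-injective : ∀ {i j x y} → place i x ≡ place j y → i ≡ j × x ≡ y
  place-injective {i} {j} {x} {y} eq =
    combine-injective i x j y (inject≤-injective ck≤n ck≤n _ _ eq)

  place-mono-< : ∀ i {x y} → x < y → place i x < place i y
  place-mono-< i {x} {y} x<y = subst₂ ℕ._<_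
    (sym (toℕ-inject≤ _ ck≤n)) (sym (toℕ-inject≤ _ ck≤n)) (combine-monoʳ-< i x<y)

  placeEdge : Fin c → Edge k → Edge n
  placeEdge i (mkEdge x y x<y) = mkEdge (place i x) (place i y) (place-mono-< i x<y)

  placeEdge-injective : ∀ {i j e f} → placeEdge i e ≡ placeEdge j f → i ≡ j × e ≡ f
  placeEdge-injective eq =
    let (i≡j , src≡) = place-injective (cong src eq)
        (_   , tgt≡) = place-injective (cong tgt eq)
    in i≡j , edge-≡ src≡ tgt≡

  module _ (es : List (Edge k)) where

    -- The copies are listed one after another; later arguments compare labels only within one copy.
    copiedEdge : Fin (c ℕ.* length es) → Edge n
    copiedEdge p = let (i , j) = remQuot (length es) p in placeEdge i (lookup es j)

    copiedEdge-injective : Unique es → Injective _≡_ _≡_ copiedEdge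
    copiedEdge-injective u {p} {q} eq =
      let (i≡ , e≡) = placeEdge-injective eq in begin
      p                                            ≡⟨ combine-remQuot {c} (length es) p ⟨
      uncurry combine (remQuot {c} (length es) p)  ≡⟨ cong₂ combine i≡ (lookup-injective u e≡) ⟩
      uncurry combine (remQuot {c} (length es) q)  ≡⟨ combine-remQuot {c} (length es) q ⟩
      q                                            ∎
      where open ≡-Reasoning

    label : Fin c → Fin (length es) → Fin (length (tabulate copiedEdge))
    label i j = cast (sym (length-tabulate copiedEdge)) (combine i j)

    label-mono-< : ∀ i {j l} → j < l → label i j < label i l
    label-mono-< i j<l = subst₂ ℕ._<_
      (sym (toℕ-cast _ _)) (sym (toℕ-cast _ _)) (combine-monoʳ-< i j<l)

    lookup-label : ∀ i j → lookup (tabulate copiedEdge) (label i j) ≡ placeEdge i (lookup es j)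
    lookup-label i j = trans (lookup-tabulate copiedEdge (combine i j))
      (cong (λ (i′ , j′) → placeEdge i′ (lookup es j′)) (remQuot-combine i j))

  copies : EdgeOrderedGraph k → EdgeOrderedGraph n
  copies (mkGraph es u) =
    mkGraph (tabulate (copiedEdge es)) (tabulate⁺ (copiedEdge-injective es u))

  size-copies : ∀ G → size (copies G) ≡ c ℕ.* size G
  size-copies G = length-tabulate (copiedEdge (edges G))

  Avoids : Fin n → Fin c → Set
  Avoids u i = ∀ x → place i x ≢ u

  avoids? : ∀ u i → Dec (Avoids u i)
  avoids? u i = all? λ x → ¬? (place i x ≟ u)

  -- Pigeonhole: otherwise two copies share u or share v.
  avoiding : 2 ℕ.< c → ∀ u v → ∃[ i ] Avoids u i × Avoids v i
  avoiding 2<c u v with any? (λ i → avoids? u i ×-dec avoids? v i)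
  ... | yes p   = p
  ... | no none =
    let (i , j , i<j , eq) = pigeonhole 2<c (proj₁ ∘ met)
    in contradiction (sameCopy (proj₁ (met i)) (proj₂ (met i))
         (subst (λ b → ∃[ x ] place j x ≡ end b) (sym eq) (proj₂ (met j)))) (<⇒≢ i<j)
    where
    end : Fin 2 → Fin n
    end zero    = u
    end (suc _) = v

    meets : ∀ w i → ¬ Avoids w i → ∃[ x ] place i x ≡ w
    meets w i ¬avoids with any? (λ x → place i x ≟ w)
    ... | yes p = p
    ... | no ¬p = contradiction (λ x eq → ¬p (x , eq)) ¬avoids

    met : ∀ i → ∃[ b ] ∃[ x ] place i x ≡ end b
    met i with avoids? u i
    ... | no ¬a = zero , meets u i ¬a
    ... | yes a = suc zero , meets v i (λ a′ → none (i , a , a′))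

    sameCopy : ∀ {i j} b → ∃[ x ] place i x ≡ end b → ∃[ y ] place j y ≡ end b → i ≡ j
    sameCopy b (_ , p) (_ , q) = proj₁ (place-injective (trans p (sym q)))

  -- The copy of `G` through an inserted edge

  module _ {a : Edge k} {es : List (Edge k)} .{u : Unique (a ∷ es)}
           (isolated : IsIsolatedEdge (mkGraph (a ∷ es) u) zero)
           (e : Edge n) (i : Fin c) (src-avoids : Avoids (src e) i) (tgt-avoids : Avoids (tgt e) i)
           where

    private
      G = mkGraph (a ∷ es) u

      φ₀ φ : Fin k → Fin n
      φ₀ = updateAt (place i) (src a) (const (src e))
      φ  = updateAt φ₀ (tgt a) (const (tgt e))

      φ-injective : Injective _≡_ _≡_ φ
      φ-injective = updateAt-injective (tgt a)
        (updateAt-injective (src a) (proj₂ ∘ place-injective) src-avoids)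
        (updateAt-avoids (src a) (src≢tgt e) tgt-avoids)

      φ-src : φ (src a) ≡ src e
      φ-src = trans (updateAt-minimal (src a) (tgt a) φ₀ (src≢tgt a))
                    (updateAt-updates (src a) (place i))

      φ-tgt : φ (tgt a) ≡ tgt e
      φ-tgt = updateAt-updates (tgt a) φ₀

      -- This is where isolation enters: a vertex of another edge is neither `src a` nor `tgt a`, so
      -- neither update touches it.
      φ-other : ∀ {x} j → x ∈ₑ lookup es j → φ x ≡ place i x
      φ-other {x} j x∈ = trans
        (updateAt-minimal x (tgt a) φ₀ λ x≡ → isolated (suc j) (λ ()) x (inj₂ x≡) x∈)
        (updateAt-minimal x (src a) (place i) λ x≡ → isolated (suc j) (λ ()) x (inj₁ x≡) x∈)

      -- Label `zero` is the inserted edge, which shifts all labels of `copies G` by one. The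
      -- minimal edge of the `i`-th copy is left out of the image.
      ψ : Fin (size G) → Fin (suc (size (copies G)))
      ψ zero    = zero
      ψ (suc j) = suc (label (a ∷ es) i (suc j))

      ψ-mono : ∀ {p q} → p < q → ψ p < ψ q
      ψ-mono {zero}  {suc q} _         = ℕ.z<s
      ψ-mono {suc p} {suc q} p<q = ℕ.s<s (label-mono-< (a ∷ es) i p<q)

    extendedCopy : .(e∉ : e ∉ edges (copies G)) →
      Σ (Copy G (insertMin (copies G) e e∉)) λ c → UsesEdge c zero
    extendedCopy e∉ = record
      { vertexMap     = φ
      ; vertexMap-inj = φ-injective
      ; edgeMap       = ψ
      ; edgeMap-mono  = ψ-mono
      ; edgeMap-joins = joins
      } , zero , refl
      where
      joins : ∀ p → Joins (edge (insertMin (copies G) e e∉) (ψ p))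
                          (φ (src (edge G p))) (φ (tgt (edge G p)))
      joins zero    = inj₁ (sym φ-src , sym φ-tgt)
      joins (suc j) = inj₁
        ( trans (cong src (lookup-label (a ∷ es) i (suc j))) (sym (φ-other j (inj₁ refl)))
        , trans (cong tgt (lookup-label (a ∷ es) i (suc j))) (sym (φ-other j (inj₂ refl))))

copies-semiSaturated : ∀ (G : EdgeOrderedGraph k) e₀ → IsMinimalEdge G e₀ → IsIsolatedEdge G e₀ →
  (3k≤n : 3 ℕ.* k ℕ.≤ n) → SemiSaturated G (DisjointCopies.copies 3 k 3k≤n G)
-- Minimality forces `e₀` to be the head of the edge list.
copies-semiSaturated (mkGraph (a ∷ es) u) (suc _) minimal _ _ = contradiction (minimal zero) λ ()
copies-semiSaturated {k} (mkGraph (a ∷ es) u) zero _ isolated 3k≤n e e∉ =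
  let open DisjointCopies 3 k 3k≤n
      (i , src-avoids , tgt-avoids) = avoiding ℕ.≤-refl (src e) (tgt e)
  in extendedCopy isolated e i src-avoids tgt-avoids e∉

-- Lower bound for a non-isolated minimal edge

Uncovered : EdgeOrderedGraph n → Fin n → Set
Uncovered H v = ∀ p → ¬ (v ∈ₑ edge H p)

joins-∈ₑ : ∀ {v} {e : Edge n} {x y} → Joins e x y → v ≡ x ⊎ v ≡ y → v ∈ₑ e
joins-∈ₑ (inj₁ (p , q)) = Sum.map (λ r → trans r (sym p)) (λ r → trans r (sym q))
joins-∈ₑ (inj₂ (p , q)) = Sum.swap ∘ Sum.map (λ r → trans r (sym q)) (λ r → trans r (sym p))

vertexMap-∈ₑ : ∀ {G : EdgeOrderedGraph k} {H : EdgeOrderedGraph n} (c : Copy G H) {v} p →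
               v ∈ₑ edge G p → vertexMap c v ∈ₑ edge H (edgeMap c p)
vertexMap-∈ₑ {H = H} c p v∈ =
  joins-∈ₑ {e = edge H (edgeMap c p)} (edgeMap-joins c p)
    (Sum.map (cong (vertexMap c)) (cong (vertexMap c)) v∈)

-- Otherwise `e₀` would be strictly below `p`, giving `f e₀ < zero`. Thus only `e₀` can be mapped to
-- the inserted edge.
minimal-preimage : ∀ {G : EdgeOrderedGraph k} {e₀} → IsMinimalEdge G e₀ →
  ∀ {f : Fin (size G) → Fin (suc m)} → (∀ {p q} → p < q → f p < f q) →
  ∀ {p} → f p ≡ zero → e₀ ≡ p
minimal-preimage {e₀ = e₀} minimal {f} f-mono {p} fp≡0 with e₀ ≟ p
... | yes eq = eq
... | no ≢  with () ← subst (f e₀ <_) fp≡0 (f-mono (≤∧≢⇒< (minimal p) ≢))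

uncovered-edge : ∀ {G : EdgeOrderedGraph k} {H : EdgeOrderedGraph n} {e₀} →
  IsMinimalEdge G e₀ → SemiSaturated G H →
  ∀ e → Uncovered H (src e) → Uncovered H (tgt e) → IsIsolatedEdge G e₀
uncovered-edge {G = G} {H} {e₀} minimal sat e src-unc tgt-unc f f≢e₀ v v∈e₀ v∈f
  -- An edge of `H` has covered ends, so `e` is missing from `H`.
  with sat e (λ e∈H → src-unc (index e∈H) (inj₁ (cong src (lookup-index e∈H))))
... | c , p , cp≡0
  with refl ← minimal-preimage {G = G} minimal (edgeMap-mono c) cp≡0
  -- `cp≡0` makes the label of the image of `e₀` zero, and monotonicity makes that of `f` a
  -- successor, so `f` lands on an edge of `H`. That edge contains the image of `v`, which is an end
  -- of `e` and hence uncovered.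
  with edgeMap c e₀ | edgeMap c f | vertexMap-∈ₑ c e₀ v∈e₀ | vertexMap-∈ₑ c f v∈f
     | edgeMap-mono c (≤∧≢⇒< (minimal f) (f≢e₀ ∘ sym))
... | zero | suc q | inj₁ w≡src | w∈q | _ = src-unc q (subst (_∈ₑ edge H q) w≡src w∈q)
... | zero | suc q | inj₂ w≡tgt | w∈q | _ = tgt-unc q (subst (_∈ₑ edge H q) w≡tgt w∈q)

-- Two distinct uncovered vertices could be joined by a new edge; comparing them decides which is
-- its `src`.
uncovered-unique : ∀ {G : EdgeOrderedGraph k} {H : EdgeOrderedGraph n} {e₀} →
  IsMinimalEdge G e₀ → ¬ IsIsolatedEdge G e₀ → SemiSaturated G H →
  ∀ {u v} → Uncovered H u → Uncovered H v → u ≡ v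
uncovered-unique {G = G} {H} minimal ¬isolated sat {u} {v} u-unc v-unc with <-cmp u v
... | tri≈ _ u≡v _ = u≡v
... | tri< u<v _ _ =
  contradiction (uncovered-edge {G = G} {H} minimal sat (mkEdge u v u<v) u-unc v-unc) ¬isolated
... | tri> _ _ v<u =
  contradiction (uncovered-edge {G = G} {H} minimal sat (mkEdge v u v<u) v-unc u-unc) ¬isolated

-- Counting vertices by incident edges

order≤1+2size : ∀ (H : EdgeOrderedGraph n) →
  (∀ {u v} → Uncovered H u → Uncovered H v → u ≡ v) → n ℕ.≤ suc (size H ℕ.* 2)
order≤1+2size {n} H unique-uncovered = injective⇒≤ {f = code ∘ status} λ {u} {v} →
  code-injective (status u) (status v)
  where
  end : Fin (size H) → Fin 2 → Fin n
  end p zero    = src (edge H p)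
  end p (suc _) = tgt (edge H p)

  Status : Fin n → Set
  Status v = (∃[ p ] ∃[ b ] v ≡ end p b) ⊎ Uncovered H v

  status : ∀ v → Status v
  status v with any? (λ p → any? (λ b → v ≟ end p b))
  ... | yes covered = inj₁ covered
  ... | no ¬covered = inj₂ λ
    { p (inj₁ v≡) → ¬covered (p , zero , v≡)
    ; p (inj₂ v≡) → ¬covered (p , suc zero , v≡) }

  -- A label and a choice of end determine a covered vertex; `zero` is reserved for the uncovered
  -- one, of which there is at most one.
  code : ∀ {v} → Status v → Fin (suc (size H ℕ.* 2))
  code (inj₁ (p , b , _)) = suc (combine p b)
  code (inj₂ _)           = zero

  code-injective : ∀ {u v} (s : Status u) (t : Status v) → code s ≡ code t → u ≡ v
  code-injective (inj₁ (p , b , u≡)) (inj₁ (q , d , v≡)) eq =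
    let (p≡q , b≡d) = combine-injective p b q d (Fin.suc-injective eq)
    in trans u≡ (trans (cong₂ end p≡q b≡d) (sym v≡))
  code-injective (inj₂ u-unc) (inj₂ v-unc) _ = unique-uncovered u-unc v-unc

-- For `s = 0` the bound gives `n ≤ 1`, excluded by `2 ≤ n`; for positive `s` the summand `1` is
-- absorbed into a second `s * 2`.
≤1+2s⇒≤4s : ∀ s → 2 ℕ.≤ n → n ℕ.≤ suc (s ℕ.* 2) → n ℕ.≤ 4 ℕ.* s
≤1+2s⇒≤4s zero 2≤n n≤ = contradiction (ℕ.≤-trans 2≤n n≤) λ { (ℕ.s≤s ()) }
≤1+2s⇒≤4s {n} (suc s) 2≤n n≤ = begin
  n                            ≤⟨ n≤ ⟩
  1 ℕ.+ suc s ℕ.* 2            ≤⟨ ℕ.+-monoˡ-≤ (suc s ℕ.* 2) {1} {suc s ℕ.* 2} (ℕ.s≤s ℕ.z≤n) ⟩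
  suc s ℕ.* 2 ℕ.+ suc s ℕ.* 2  ≡⟨ ℕ.*-distribˡ-+ (suc s) 2 2 ⟨
  suc s ℕ.* 4                  ≡⟨ ℕ.*-comm (suc s) 4 ⟩
  4 ℕ.* suc s                  ∎
  where open ℕ.≤-Reasoning

claim6 : ∀ {k : ℕ} (G : EdgeOrderedGraph k) (e₀ : Fin (size G)) → IsMinimalEdge G e₀ →
    (IsIsolatedEdge G e₀ → (λ n → ssatₘ n G) ∈O (λ n → 1)) ×
    (¬ (IsIsolatedEdge G e₀) → (λ n → ssatₘ n G) ∈Ω (λ n → n))
claim6 {k} G e₀ minimal =
  -- From `n = 3 * k` on there is room for three disjoint copies, and their number of edges does not
  -- depend on `n`.
  (λ isolated → bounded⇒∈O1 (λ n → ssatₘ n G) (3 ℕ.* size G) (3 ℕ.* k) λ n 3k≤n →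
    lowerBound (ssatₘ-isMinimum n G) (3 ℕ.* size G)
      ( DisjointCopies.copies 3 k 3k≤n G
      , copies-semiSaturated G e₀ minimal isolated 3k≤n
      , DisjointCopies.size-copies 3 k 3k≤n G)) ,
  (λ ¬isolated → linear⇒∈Ωn (λ n → ssatₘ n G) 2 λ n 2≤n →
    let (H , sat , size≡) = attained (ssatₘ-isMinimum n G) in
    ≤1+2s⇒≤4s (ssatₘ n G) 2≤n (subst (λ s → n ℕ.≤ suc (s ℕ.* 2)) size≡
      (order≤1+2size H (uncovered-unique {G = G} {H} minimal ¬isolated sat))))
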